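{- Let $\kappa$ be inaccessible and let $b:\kappa\to\kappa$ be an increasing function such that each $b(\alpha)$ is an infinite cardinal. If $\lambda<\kappa$ is a regular cardinal and $\mathrm{cf}(b(\alpha))=\lambda$ for cofinally many $\alpha\in\kappa$, then $\mathfrak d_\kappa^b(\leq^*)=2^\kappa$.
   Context: "Increasing" means not necessarily strictly increasing. $\prod b$ is the set of functions $f$ with domain $\kappa$ and $f(\alpha)\in b(\alpha)$ for all $\alpha\in\kappa$. $f\leq^*g$ means that there is $\beta<\kappa$ with $f(\alpha)\leq g(\alpha)$ for all $\alpha>\beta$. "Cofinally many" means unboundedly many in $\kappa$. The dominating number $\mathfrak d_\kappa^b(\leq^*)$ is the least size of a set $D\subseteq\prod b$ such that for every $f\in\prod b$ there is $g\in D$ with $f\leq^*g$. -}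

module Defs where

open import Level using (Level; suc; _⊔_)
open import Data.Bool.Base using (Bool)
open import Data.Nat.Base using (ℕ)
open import Data.Product using (Σ; Σ-syntax; ∃; ∃-syntax; _×_; _,_; proj₁; proj₂)
open import Function.Base using (_on_)
open import Function.Bundles using (Func; Injection; Inverse)
open import Induction.WellFounded using (WellFounded)
open import Relation.Binary.Bundles using (Setoid)
open import Relation.Binary.Core using (Rel; REL; _Preserves_⟶_)
open import Relation.Binary.Definitions
  using (Irrelevant; Trichotomous; _Respectsˡ_; _Respectsʳ_; tri<; tri≈; tri>)
open import Relation.Binary.Structures using (IsStrictTotalOrder)
import Relation.Binary.Construct.On as On
import Relation.Binary.Construct.StrictToNonStrict as StrictToNonStrict
open import Relation.Binary.PropositionalEquality
  using (_≡_; refl; cong; isEquivalence; _→-setoid_; setoid; resp₂)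
open import Relation.Nullary using (¬_)
open import Relation.Unary using (Pred)

private
  variable
    a b ℓ ℓ₁ ℓ₂ : Level

-- Sets are setoids: functions are compared pointwise, so choice must be the
-- extensional axiom, whose choice functions respect the equalities.  (The
-- version without that requirement is provable in type theory.)
ExtensionalChoice : ∀ a ℓ₁ b ℓ₂ r → Set (suc (a ⊔ ℓ₁ ⊔ b ⊔ ℓ₂ ⊔ r))
ExtensionalChoice a ℓ₁ b ℓ₂ r =
  (X : Setoid a ℓ₁) (Y : Setoid b ℓ₂) →
  let module X = Setoid X
      module Y = Setoid Y
  in
  (R : REL X.Carrier Y.Carrier r) →
  R Respectsˡ X._≈_ → R Respectsʳ Y._≈_ →
  (∀ x → ∃[ y ] R x y) →
  Σ[ f ∈ Func X Y ] (∀ x → R x (Func.to f x))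

-- Cardinals are represented by sets having that cardinality.

infix 4 _≈ᶜ_ _≼_ _≺_

_≈ᶜ_ : Setoid a ℓ₁ → Setoid b ℓ₂ → Set (a ⊔ b ⊔ ℓ₁ ⊔ ℓ₂)
X ≈ᶜ Y = Inverse X Y

_≼_ : Setoid a ℓ₁ → Setoid b ℓ₂ → Set (a ⊔ b ⊔ ℓ₁ ⊔ ℓ₂)
X ≼ Y = Injection X Y

_≺_ : Setoid a ℓ₁ → Setoid b ℓ₂ → Set (a ⊔ b ⊔ ℓ₁ ⊔ ℓ₂)
X ≺ Y = X ≼ Y × ¬ (Y ≼ X)

ℵ₀ : Setoid _ _
ℵ₀ = setoid ℕ

2^_ : Set a → Setoid a a
2^ A = A →-setoid Bool

-- An ordinal is presented as a well-ordered type, whose elements stand for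
-- the smaller ordinals.
record Ordinal (ℓ : Level) : Set (suc ℓ) where
  infix 4 _<_
  field
    Carrier            : Set ℓ
    _<_                : Rel Carrier ℓ
    isStrictTotalOrder : IsStrictTotalOrder _≡_ _<_
    <-wellFounded      : WellFounded _<_
    -- Makes elements of an initial segment equal as soon as the underlying
    -- elements are.
    <-irrelevant       : Irrelevant _<_

  open IsStrictTotalOrder isStrictTotalOrder public using (compare; trans; irrefl)
  open StrictToNonStrict _≡_ _<_ public using (_≤_)

  asSetoid : Setoid ℓ ℓ
  asSetoid = setoid Carrier

∣_∣ : Ordinal ℓ → Setoid ℓ ℓ
∣ γ ∣ = Ordinal.asSetoid γ

-- The element α of γ as an ordinal in its own right: the set of all β < α.
infixl 9 _↓_
_↓_ : (γ : Ordinal ℓ) → Ordinal.Carrier γ → Ordinal ℓ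
_↓_ {ℓ} γ α = record
  { Carrier            = Seg
  ; _<_                = _<′_
  ; isStrictTotalOrder = record
      { isStrictPartialOrder = record
          { isEquivalence = isEquivalence
          ; irrefl        = λ x≡y → irrefl (cong proj₁ x≡y)
          ; trans         = trans
          ; <-resp-≈      = resp₂ _<′_
          }
      ; compare = compare′
      }
  ; <-wellFounded      = On.wellFounded proj₁ <-wellFounded
  ; <-irrelevant       = <-irrelevant
  }
  where
  open Ordinal γ

  Seg : Set ℓ
  Seg = Σ[ β ∈ Carrier ] β < α

  _<′_ : Rel Seg ℓ
  _<′_ = _<_ on proj₁

  seg-≡ : {x y : Seg} → proj₁ x ≡ proj₁ y → x ≡ y
  seg-≡ {β , p} {.β , q} refl = cong (β ,_) (<-irrelevant p q)

  compare′ : Trichotomous _≡_ _<′_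
  compare′ x y with compare (proj₁ x) (proj₁ y)
  ... | tri< p q r = tri< p (λ e → q (cong proj₁ e)) r
  ... | tri≈ p q r = tri≈ p (seg-≡ q) r
  ... | tri> p q r = tri> p (λ e → q (cong proj₁ e)) r

IsCardinal : Ordinal ℓ → Set ℓ
IsCardinal γ = ∀ α → ¬ (∣ γ ↓ α ∣ ≈ᶜ ∣ γ ∣)

IsInfiniteCardinal : Ordinal ℓ → Set ℓ
IsInfiniteCardinal γ = IsCardinal γ × ℵ₀ ≼ ∣ γ ∣

CofinalMap : Ordinal ℓ → Ordinal ℓ → Set ℓ
CofinalMap δ γ =
  Σ[ f ∈ (Ordinal.Carrier δ → Ordinal.Carrier γ) ]
    (∀ x → ∃[ y ] Ordinal._≤_ γ x (f y))

-- cf(γ) = δ: δ is the least ordinal with a cofinal map into γ.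
HasCofinality : Ordinal ℓ → Ordinal ℓ → Set ℓ
HasCofinality γ δ = CofinalMap δ γ × (∀ ξ → ¬ CofinalMap (δ ↓ ξ) γ)

IsRegularCardinal : Ordinal ℓ → Set ℓ
IsRegularCardinal γ = IsInfiniteCardinal γ × HasCofinality γ γ

IsInaccessible : Ordinal ℓ → Set ℓ
IsInaccessible κ =
  IsRegularCardinal κ ×
  ℵ₀ ≺ ∣ κ ∣ ×
  (∀ α → 2^ (Ordinal.Carrier (κ ↓ α)) ≺ ∣ κ ∣)

module _ (κ : Ordinal ℓ) where
  open Ordinal κ

  IsIncreasing : (Carrier → Carrier) → Set ℓ
  IsIncreasing b = b Preserves _≤_ ⟶ _≤_

  CofinallyMany : Pred Carrier ℓ → Set ℓ
  CofinallyMany P = ∀ β → ∃[ α ] (β < α × P α)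

  module _ (b : Carrier → Carrier) where

    ∏ : Set ℓ
    ∏ = Σ[ f ∈ (Carrier → Carrier) ] (∀ α → f α < b α)

    infix 4 _≤*_
    _≤*_ : Rel ∏ ℓ
    (f , _) ≤* (g , _) = ∃[ β ] (∀ α → β < α → f α ≤ g α)

    -- The subset D of ∏ as a set, with equality of functions.
    -- D itself need not respect pointwise equality; what is described is then
    -- the set of all functions pointwise equal to some element of D.
    subset : Pred ∏ ℓ → Setoid ℓ ℓ
    subset D = On.setoid {B = ∃ D} (Carrier →-setoid Carrier) (λ x → proj₁ (proj₁ x))

    IsDominating : Pred ∏ ℓ → Set ℓ
    IsDominating D = ∀ f → ∃[ g ] (D g × f ≤* g)

    -- 𝔡 = |S|: some dominating set has size |S|, and none has smaller size.
    IsDominatingNumber : Setoid ℓ ℓ → Set (suc ℓ)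
    IsDominatingNumber S =
      (∃[ D ] (IsDominating D × subset D ≈ᶜ S)) ×
      (∀ D → IsDominating D → S ≼ subset D)

{-# OPTIONS --safe #-}
-- Fix an injective pairing q of κ × κ into the set of α with cf(b(α)) = μ; a
-- set T ⊆ κ then has rows { ξ : q(i,ξ) ∈ T } for i < μ, and α = q(δ,x) with x
-- coding T ∩ δ (possible as 2^δ < κ) codes the table T ∩ δ.  Each η ∈ 2^κ
-- gives a function in ∏ b whose value at such an α is the i-th member of a
-- cofinal μ-sequence in b(α), where i is the unique row of T agreeing with η
-- below δ.  If g dominated the functions of distinct η_i for all i < μ, let T
-- have rows η_i and take δ so large that they already differ below δ: then
-- g(α) bounds the whole cofinal sequence, which is impossible.  So every g
-- dominates the functions of at most μ many η, and by a König-style diagonal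
-- argument any dominating set maps onto 2^κ.
module Submission where

open import Level using (Level; _⊔_)
open import Axiom.ExcludedMiddle using (ExcludedMiddle)
open import Data.Bool.Base using (Bool; true; false)
open import Data.Product using (Σ-syntax; ∃; ∃-syntax; _×_; _,_; proj₁; proj₂; uncurry)
open import Data.Product.Properties using (,-injectiveˡ; ,-injectiveʳ)
open import Data.Product.Relation.Binary.Lex.Strict
  using (×-Lex; ×-wellFounded; ×-compare)
open import Data.Sum.Base using (_⊎_; inj₁; inj₂)
open import Data.Unit.Polymorphic using (⊤)
open import Function.Base using (_∘_; _on_; case_of_)
open import Function.Bundles using (Func; Injection)
open import Function.Definitions using (Injective)
open import Induction.WellFounded using (WellFounded; WfRec; module All; module FixPoint)
open import Relation.Binary.Bundles using (Setoid)
open import Relation.Binary.Core using (Rel)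
open import Relation.Binary.Definitions using (tri<; tri≈; tri>)
import Relation.Binary.Construct.On as On
open import Relation.Binary.PropositionalEquality
  using (_≡_; refl; sym; trans; cong; subst; _→-setoid_; setoid)
open import Relation.Nullary using (¬_; yes; no; contradiction; ⌊_⌋)
open import Relation.Nullary.Decidable using (decidable-stable)
open import Relation.Unary using (Pred)
open import Defs

private
  variable
    a b ℓ ℓ₁ ℓ₂ r s : Level

-- Classical preliminaries: the Cantor-Bernstein theorem and truth values.

module _ (em : ∀ {a} → ExcludedMiddle a) where

  ¬∀⟶∃¬ : {A : Set a} {P : A → Set r} → ¬ (∀ x → P x) → ∃[ x ] ¬ P x
  ¬∀⟶∃¬ ¬∀ = decidable-stable em λ ¬∃ →
    ¬∀ λ x → decidable-stable em λ ¬Px → ¬∃ (x , ¬Px)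

  module _ {a ℓ₁ b ℓ₂} {X : Setoid a ℓ₁} {Y : Setoid b ℓ₂} (f : X ≼ Y) (g : Y ≼ X) where
    private
      module X = Setoid X
      module Y = Setoid Y
      module f = Injection f
      module g = Injection g

      -- The elements whose backward chain through `g` and `f` stops outside the image of `g`. The
      -- bijection follows `f` on these and the inverse of `g` on the rest.
      data Orphaned : X.Carrier → Set (a ⊔ ℓ₁ ⊔ b) where
        orphan     : ∀ {x} → (∀ y → ¬ g.to y X.≈ x) → Orphaned x
        descendant : ∀ {x x′} → Orphaned x → g.to (f.to x) X.≈ x′ → Orphaned x′

      resp : ∀ {x x′} → x X.≈ x′ → Orphaned x → Orphaned x′
      resp x≈x′ (orphan ∉g)       = orphan λ y e → ∉g y (X.trans e (X.sym x≈x′))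
      resp x≈x′ (descendant o eq) = descendant o (X.trans eq x≈x′)

      _↦_ : X.Carrier → Y.Carrier → Set _
      x ↦ y = (Orphaned x × f.to x Y.≈ y) ⊎ (¬ Orphaned x × g.to y X.≈ x)

      image : ∀ x → ∃[ y ] x ↦ y
      image x with em {P = Orphaned x}
      ... | yes o = f.to x , inj₁ (o , Y.refl)
      ... | no ¬o with em {P = ∃[ y ] g.to y X.≈ x}
      ...   | yes (y , eq) = y , inj₂ (¬o , eq)
      ...   | no ∉g        = contradiction (orphan λ y eq → ∉g (y , eq)) ¬o

      preimage : ∀ y → ∃[ x ] x ↦ y
      preimage y with em {P = Orphaned (g.to y)}
      ... | yes (orphan ∉g)               = contradiction X.refl (∉g y)
      ... | yes (descendant {x = x} o eq) = x , inj₁ (o , g.injective eq)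
      ... | no ¬o                         = g.to y , inj₂ (¬o , X.refl)

      functional : ∀ {x x′ y y′} → x ↦ y → x′ ↦ y′ → x X.≈ x′ → y Y.≈ y′
      functional (inj₁ (_ , p)) (inj₁ (_ , q)) e = Y.trans (Y.sym p) (Y.trans (f.cong e) q)
      functional (inj₁ (o , _)) (inj₂ (¬o , _)) e = contradiction (resp e o) ¬o
      functional (inj₂ (¬o , _)) (inj₁ (o , _)) e = contradiction (resp (X.sym e) o) ¬o
      functional (inj₂ (_ , p)) (inj₂ (_ , q)) e = g.injective (X.trans p (X.trans e (X.sym q)))

      injective : ∀ {x x′ y y′} → x ↦ y → x′ ↦ y′ → y Y.≈ y′ → x X.≈ x′
      injective (inj₁ (_ , p)) (inj₁ (_ , q)) e = f.injective (Y.trans p (Y.trans e (Y.sym q)))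
      injective (inj₁ (o , p)) (inj₂ (¬o , q)) e =
        contradiction (descendant o (X.trans (g.cong (Y.trans p e)) q)) ¬o
      injective (inj₂ (¬o , p)) (inj₁ (o , q)) e =
        contradiction (descendant o (X.trans (g.cong (Y.trans q (Y.sym e))) p)) ¬o
      injective (inj₂ (_ , p)) (inj₂ (_ , q)) e = X.trans (X.sym p) (X.trans (g.cong e) q)

    cantor-bernstein : X ≈ᶜ Y
    cantor-bernstein = record
      { to        = proj₁ ∘ image
      ; from      = proj₁ ∘ preimage
      ; to-cong   = functional (proj₂ (image _)) (proj₂ (image _))
      ; from-cong = injective (proj₂ (preimage _)) (proj₂ (preimage _))
      ; inverse   =
          functional (proj₂ (image _)) (proj₂ (preimage _)) ,
          injective (proj₂ (preimage _)) (proj₂ (image _))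
      }

  extension : {A : Set a} {B : Set b} (m : A → B) → Injective _≡_ _≡_ m →
              (f : A → Bool) → Σ[ F ∈ (B → Bool) ] (∀ x → F (m x) ≡ f x)
  extension {A = A} m inj f = F , correct
    where
    F : _ → Bool
    F y with em {P = ∃[ x ] m x ≡ y}
    ... | yes (x , _) = f x
    ... | no _        = false

    correct : ∀ x → F (m x) ≡ f x
    correct x with em {P = ∃[ x′ ] m x′ ≡ m x}
    ... | yes (x′ , eq) = cong f (inj eq)
    ... | no ∉m         = contradiction (x , refl) ∉m

  ⌊⌋-injective : {P : Set a} {Q : Set b} → ⌊ em {P = P} ⌋ ≡ ⌊ em {P = Q} ⌋ → P → Q
  ⌊⌋-injective {P = P} {Q = Q} eq p with em {P = P} | em {P = Q}
  ... | yes _ | yes q = q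
  ... | no ¬p | _     = contradiction p ¬p
  ⌊⌋-injective () p | yes _ | no _

  ⌊⌋-cong : {P : Set a} {Q : Set b} → (P → Q) → (Q → P) → ⌊ em {P = P} ⌋ ≡ ⌊ em {P = Q} ⌋
  ⌊⌋-cong {P = P} {Q = Q} f g with em {P = P} | em {P = Q}
  ... | yes _ | yes _ = refl
  ... | no _  | no _  = refl
  ... | yes p | no ¬q = contradiction (f p) ¬q
  ... | no ¬p | yes q = contradiction (g q) ¬p

-- Consequences of extensional choice.

module _ (em : ∀ {a} → ExcludedMiddle a)
         (ec : ∀ {a ℓ₁ b ℓ₂ r} → ExtensionalChoice a ℓ₁ b ℓ₂ r) where

  choice : {A : Set a} {B : Set b} {R : A → B → Set r} →
           (∀ x → ∃ (R x)) → Σ[ f ∈ (A → B) ] (∀ x → R x (f x))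
  choice {A = A} {B} {R} tot =
    let f , Rf = ec (setoid A) (setoid B) R (λ { refl p → p }) (λ { refl p → p }) tot
    in Func.to f , Rf

  -- Well-founded recursion with a choice at every step. By `local`, `R x` sees `h` only below `x`,
  -- so the filler values `y₀` elsewhere do no harm.
  dependentChoice :
    {A : Set a} {_◁_ : Rel A r} → WellFounded _◁_ → {B : Set b} → (A → B) →
    (R : A → (A → B) → B → Set s) →
    (∀ x {h h′ y} → (∀ z → z ◁ x → h z ≡ h′ z) → R x h y → R x h′ y) →
    (∀ x h → ∃ (R x h)) →
    Σ[ F ∈ (A → B) ] (∀ x → R x F (F x))
  dependentChoice {A = A} {_◁_} wf {B} y₀ R local tot = F , F-spec
    where
    -- Extensional choice over this setoid makes the recursion step depend only
    -- on the values below x, as the unfolding of well-founded recursion needs.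
    below : A → Setoid _ _
    below x = record
      { Carrier       = A → B
      ; _≈_           = λ h h′ → ∀ z → z ◁ x → h z ≡ h′ z
      ; isEquivalence = record
          { refl  = λ _ _ → refl
          ; sym   = λ e z p → sym (e z p)
          ; trans = λ e e′ z p → trans (e z p) (e′ z p)
          }
      }

    pick : ∀ x → Σ[ f ∈ Func (below x) (setoid B) ] (∀ h → R x h (Func.to f h))
    pick x = ec (below x) (setoid B) (R x) (local x) (λ { refl p → p }) (tot x)

    totalise : ∀ x → WfRec _◁_ (λ _ → B) x → A → B
    totalise x h z with em {P = z ◁ x}
    ... | yes p = h p
    ... | no _  = y₀ z

    step : ∀ x → WfRec _◁_ (λ _ → B) x → B
    step x h = Func.to (proj₁ (pick x)) (totalise x h)

    step-ext : ∀ x {h h′ : WfRec _◁_ (λ _ → B) x} →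
               (∀ {z} (p : z ◁ x) → h p ≡ h′ p) → step x h ≡ step x h′
    step-ext x {h} {h′} e = Func.cong (proj₁ (pick x)) agree
      where
      agree : ∀ z → z ◁ x → totalise x h z ≡ totalise x h′ z
      agree z _ with em {P = z ◁ x}
      ... | yes p = e p
      ... | no _  = refl

    F : A → B
    F = All.wfRec wf _ (λ _ → B) step

    totalise-F : ∀ x z → z ◁ x → totalise x (λ {y} _ → F y) z ≡ F z
    totalise-F x z p with em {P = z ◁ x}
    ... | yes _ = refl
    ... | no ¬p = contradiction p ¬p

    F-spec : ∀ x → R x F (F x)
    F-spec x = subst (R x F) (sym (FixPoint.unfold-wfRec wf (λ _ → B) step step-ext))
      (local x (totalise-F x) (proj₂ (pick x) _))

  -- Pick new members of `P` by recursion along `γ`. If every stage can be continued, the result is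
  -- injective; otherwise the `h` of a stuck stage already lists `P`.
  embeds-or-enumerates :
    (γ : Ordinal ℓ) (S : Setoid a ℓ₁) → let open Setoid S renaming (Carrier to A) in
    A → (P : Pred A r) →
    (Σ[ h ∈ (Ordinal.Carrier γ → A) ]
      ((∀ i → P (h i)) × (∀ i j → h i ≈ h j → i ≡ j))) ⊎
    (Σ[ h ∈ (Ordinal.Carrier γ → A) ] (∀ x → P x → ∃[ i ] h i ≈ x))
  embeds-or-enumerates γ S x₀ P
    with em {P = ∀ i h → ∃[ x ] (P x × ∀ j → j < i → ¬ h j ≈ x)}
    where open Ordinal γ using (_<_)
          open Setoid S using (_≈_)
  ... | yes fresh = inj₁ (h , proj₁ ∘ h-spec , distinct)
    where
    open Ordinal γ using (_<_; <-wellFounded; compare)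
    open Setoid S using (_≈_) renaming (sym to ≈-sym)

    sequence : Σ[ h ∈ _ ] (∀ i → P (h i) × ∀ j → j < i → ¬ h j ≈ h i)
    sequence = dependentChoice <-wellFounded (λ _ → x₀)
      (λ i h x → P x × ∀ j → j < i → ¬ h j ≈ x)
      (λ { i e (Px , new) → Px , λ j j<i → subst (λ y → ¬ y ≈ _) (e j j<i) (new j j<i) })
      fresh

    h = proj₁ sequence
    h-spec = proj₂ sequence

    distinct : ∀ i j → h i ≈ h j → i ≡ j
    distinct i j e with compare i j
    ... | tri< i<j _ _ = contradiction e (proj₂ (h-spec j) i i<j)
    ... | tri≈ _ i≡j _ = i≡j
    ... | tri> _ _ j<i = contradiction (≈-sym e) (proj₂ (h-spec i) j j<i)
  ... | no ¬fresh = inj₂ (h , λ x Px → decidable-stable em λ ∉h →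
          ¬new (x , Px , λ j _ e → ∉h (j , e)))
    where
    stuck = ¬∀⟶∃¬ em (proj₂ (¬∀⟶∃¬ em ¬fresh))
    h = proj₁ stuck
    ¬new = proj₂ stuck

  -- Regular cardinals: bounds for small families and an injective pairing.

  module _ (κ : Ordinal ℓ) (κ-regular : HasCofinality κ κ) where
    open Ordinal κ renaming (trans to <-trans)

    private
      Seg : Carrier → Set ℓ
      Seg ν = Ordinal.Carrier (κ ↓ ν)

    seg-≡ : ∀ {ν} {x y : Seg ν} → proj₁ x ≡ proj₁ y → x ≡ y
    seg-≡ {x = x , p} {.x , q} refl = cong (x ,_) (<-irrelevant p q)

    ≤-<-trans : ∀ {x y z} → x ≤ y → y < z → x < z
    ≤-<-trans (inj₁ x<y)  y<z = <-trans x<y y<z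
    ≤-<-trans (inj₂ refl) y<z = y<z

    ≮⇒≥ : ∀ {x y} → ¬ x < y → y ≤ x
    ≮⇒≥ {x} {y} x≮y with compare x y
    ... | tri< x<y _ _ = contradiction x<y x≮y
    ... | tri≈ _ x≡y _ = inj₂ (sym x≡y)
    ... | tri> _ _ y<x = inj₁ y<x

    max : ∀ x y → ∃[ z ] (x ≤ z × y ≤ z)
    max x y with compare x y
    ... | tri< x<y _ _ = y , inj₁ x<y , inj₂ refl
    ... | tri≈ _ x≡y _ = y , inj₂ x≡y , inj₂ refl
    ... | tri> _ _ y<x = x , inj₂ refl , inj₁ y<x

    cofinal₂ : (P : Pred Carrier ℓ) → CofinallyMany κ P →
               ∀ x y → ∃[ α ] (x < α × y < α × P α)
    cofinal₂ P cofinal x y =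
      let z , x≤z , y≤z = max x y
          α , z<α , Pα = cofinal z
      in α , ≤-<-trans x≤z z<α , ≤-<-trans y≤z z<α , Pα

    -- An unbounded `h` would be a cofinal map from a proper initial segment, against regularity.
    bounded : ∀ {ν} (h : Seg ν → Carrier) → ∃[ β ] (∀ x → h x < β)
    bounded {ν} h = decidable-stable em λ unbounded →
      proj₂ κ-regular ν (h , λ β →
        let x , hx≮β = ¬∀⟶∃¬ em (λ all → unbounded (β , all)) in x , ≮⇒≥ hx≮β)

    bounded₂ : ∀ {ν} (h : Seg ν → Seg ν → Carrier) → ∃[ β ] (∀ x y → h x y < β)
    bounded₂ h =
      let β , h<β = choice (λ x → bounded (h x))
          γ , β<γ = bounded β
      in γ , λ x y → <-trans (h<β x y) (β<γ x)

    module _ (P : Pred Carrier ℓ) (cofinal : CofinallyMany κ P) where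
      private
        Pair = Carrier × Carrier

        bound : Pair → Carrier
        bound (x , y) = proj₁ (max x y)

        ≤-bound₁ : ∀ x y → x ≤ bound (x , y)
        ≤-bound₁ x y = proj₁ (proj₂ (max x y))

        ≤-bound₂ : ∀ x y → y ≤ bound (x , y)
        ≤-bound₂ x y = proj₂ (proj₂ (max x y))

        _⊏_ : Rel (Carrier × Pair) ℓ
        _⊏_ = ×-Lex _≡_ _<_ (×-Lex _≡_ _<_ _<_)

        -- Gödel's order on pairs: its initial segments are bounded.
        _◁_ : Rel Pair ℓ
        _◁_ = _⊏_ on λ p → bound p , p

        ◁-wellFounded : WellFounded _◁_
        ◁-wellFounded = On.wellFounded (λ p → bound p , p)
          (×-wellFounded <-wellFounded (×-wellFounded <-wellFounded <-wellFounded))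

        ◁⇒bound≤ : ∀ {p p′} → p ◁ p′ → bound p ≤ bound p′
        ◁⇒bound≤ (inj₁ lt)       = inj₁ lt
        ◁⇒bound≤ (inj₂ (eq , _)) = inj₂ eq

        -- Exceeding all earlier values yields injectivity; exceeding the first coordinate will
        -- place the code of a table cut off at `δ` above `δ`.
        Next : Pair → (Pair → Carrier) → Carrier → Set ℓ
        Next p h α = P α × proj₁ p < α × (∀ p′ → p′ ◁ p → h p′ < α)

        next : ∀ p h → ∃ (Next p h)
        next p h = finish (cofinal (bound p))
          where
          finish : ∃[ ν ] (bound p < ν × P ν) → ∃ (Next p h)
          finish (ν , p<ν , _) = α , Pα , p<α , h<α
            where
            -- Both coordinates of every predecessor of `p` lie below `ν`, so regularity bounds the
            -- values already taken.
            h-bounded = bounded₂ {ν} λ x y → h (proj₁ x , proj₁ y)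
            above = cofinal₂ P cofinal (proj₁ p) (proj₁ h-bounded)

            α = proj₁ above
            p<α = proj₁ (proj₂ above)
            Pα = proj₂ (proj₂ (proj₂ above))

            h<α : ∀ p′ → p′ ◁ p → h p′ < α
            h<α (x , y) p′◁p = <-trans
              (proj₂ h-bounded (x , ≤-<-trans (≤-bound₁ x y) p′<ν) (y , ≤-<-trans (≤-bound₂ x y) p′<ν))
              (proj₁ (proj₂ (proj₂ above)))
              where
              p′<ν = ≤-<-trans (◁⇒bound≤ {x , y} {p} p′◁p) p<ν

        pairing : Σ[ q ∈ (Pair → Carrier) ] (∀ p → Next p q (q p))
        pairing = dependentChoice ◁-wellFounded proj₁ Next
          (λ { p e (Pα , p<α , h<α) → Pα , p<α , λ z z◁p → subst (_< _) (e z z◁p) (h<α z z◁p) })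
          next

        q = proj₁ pairing
        q-spec = proj₂ pairing

        q-injective : Injective _≡_ _≡_ q
        q-injective {p} {p′} eq =
          case ×-compare sym compare (×-compare sym compare compare) (bound p , p) (bound p′ , p′) of λ
            { (tri< p◁p′ _ _) → contradiction (proj₂ (proj₂ (q-spec p′)) p p◁p′) (irrefl eq)
            ; (tri≈ _ (_ , refl , refl) _) → refl
            ; (tri> _ _ p′◁p) → contradiction (proj₂ (proj₂ (q-spec p)) p′ p′◁p) (irrefl (sym eq))
            }

      abstract
        injectivePairing :
          Σ[ q ∈ (Carrier × Carrier → Carrier) ]
            (Injective _≡_ _≡_ q × (∀ p → P (q p) × proj₁ p < q p))
        injectivePairing = q , q-injective , λ p → proj₁ (q-spec p) , proj₁ (proj₂ (q-spec p))

  -- Tables, their codes, and the functions attached to subsets of `κ`.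

  module _
    (κ : Ordinal ℓ) (κ-inaccessible : IsInaccessible κ)
    (b : Ordinal.Carrier κ → Ordinal.Carrier κ)
    (b-infinite : ∀ α → IsInfiniteCardinal (κ ↓ b α))
    (μ : Ordinal.Carrier κ) (ℵ₀≼μ : ℵ₀ ≼ ∣ κ ↓ μ ∣)
    (cofinal : CofinallyMany κ (λ α → HasCofinality (κ ↓ b α) (κ ↓ μ)))
    where
    open Ordinal κ renaming (trans to <-trans)

    private
      Seg : Carrier → Set ℓ
      Seg ν = Ordinal.Carrier (κ ↓ ν)

      κ-regular : HasCofinality κ κ
      κ-regular = proj₂ (proj₁ κ-inaccessible)

      power : ∀ δ → 2^ (Seg δ) ≼ ∣ κ ∣
      power δ = proj₁ (proj₂ (proj₂ κ-inaccessible) δ)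

      pairing = injectivePairing κ κ-regular _ cofinal

      q : Carrier × Carrier → Carrier
      q = proj₁ pairing

      q-injective : Injective _≡_ _≡_ q
      q-injective = proj₁ (proj₂ pairing)

      q-cofinality : ∀ p → HasCofinality (κ ↓ b (q p)) (κ ↓ μ)
      q-cofinality p = proj₁ (proj₂ (proj₂ pairing) p)

      q-above : ∀ p → proj₁ p < q p
      q-above p = proj₂ (proj₂ (proj₂ pairing) p)

      climb : ∀ p → Seg μ → Seg (b (q p))
      climb p = proj₁ (proj₁ (q-cofinality p))

      cell : Seg μ × Carrier → Carrier
      cell (i , ξ) = q (proj₁ i , ξ)

      cell-injective : Injective _≡_ _≡_ cell
      cell-injective {i , ξ} {j , ζ} eq
        with refl ← seg-≡ κ κ-regular {x = i} {j} (,-injectiveˡ (q-injective eq))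
        = cong (i ,_) (,-injectiveʳ (q-injective eq))

      -- By inaccessibility an element of `κ` names the part of `T` below `δ`. Hence `q (code δ T)`
      -- determines `δ` and that part, and nothing more of `T`.
      code : Carrier → (Carrier → Bool) → Carrier × Carrier
      code δ T = δ , Injection.to (power δ) (T ∘ proj₁)

    climb-unbounded : ∀ p γ → ¬ (∀ i → proj₁ (climb p i) ≤ proj₁ {B = _< b (q p)} γ)
    climb-unbounded p γ climb≤γ =
      -- The images of 0 and 1 are distinct, and the smaller one makes the segment below the larger
      -- one nonempty.
      case Ordinal.compare (κ ↓ μ) (nth 0) (nth 1) of λ
        { (tri< lt _ _) → no-predecessor (nth 0) (nth 1) lt
        ; (tri≈ _ eq _) → case Injection.injective ℵ₀≼μ eq of λ ()
        ; (tri> _ _ lt) → no-predecessor (nth 1) (nth 0) lt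
        }
      where
      nth = Injection.to ℵ₀≼μ

      γ-greatest : ∀ x → Ordinal._≤_ (κ ↓ b (q p)) x γ
      γ-greatest x with proj₂ (proj₁ (q-cofinality p)) x
      ... | i , inj₂ refl with climb≤γ i
      ...   | inj₁ x<γ = inj₁ x<γ
      ...   | inj₂ x≡γ = inj₂ (seg-≡ κ κ-regular x≡γ)
      γ-greatest x | i , inj₁ x<climb with climb≤γ i
      ...   | inj₁ climb<γ = inj₁ (<-trans x<climb climb<γ)
      ...   | inj₂ climb≡γ = inj₁ (subst (proj₁ x <_) climb≡γ x<climb)

      -- A greatest element is a cofinal map from the segment below j.
      no-predecessor : ∀ i j → ¬ Ordinal._<_ (κ ↓ μ) i j
      no-predecessor i j i<j =
        proj₂ (q-cofinality p) j ((λ _ → γ) , λ x → (i , i<j) , γ-greatest x)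

    Matches : Carrier → (Carrier → Bool) → (Carrier → Bool) → Seg μ → Set ℓ
    Matches δ T η i = ∀ ξ → cell (i , ξ) < δ → η ξ ≡ T (cell (i , ξ))

    -- Row `i` must be the only match: then the value depends on `η` and `α` alone, whichever `T`
    -- represents the coded part.
    Prescribed : (Carrier → Bool) → Carrier → Carrier → Set ℓ
    Prescribed η α v =
      ∃[ δ ] ∃[ T ] ∃[ i ] (α ≡ q (code δ T) × Matches δ T η i ×
        (∀ j → Matches δ T η j → j ≡ i) × v ≡ proj₁ (climb (code δ T) i))

    prescribed-bounded : ∀ {η α v} → Prescribed η α v → v < b α
    prescribed-bounded (δ , T , i , refl , _ , _ , refl) = proj₂ (climb (code δ T) i)

    prescribed-unique : ∀ {η α v w} → Prescribed η α v → Prescribed η α w → v ≡ w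
    prescribed-unique {η} (δ , T , i , refl , match , _ , refl) (δ′ , T′ , i′ , eq , _ , unique , refl)
      with refl ← ,-injectiveˡ (q-injective eq) =
      -- Equal codes make `T` and `T′` agree below `δ`, so row `i` also matches in `T′` and must be
      -- its unique match `i′`.
      climb-cong (q-injective eq) (unique i λ ξ lt → trans (match ξ lt) (T≡T′ (_ , lt)))
      where
      T≡T′ : ∀ x → T (proj₁ x) ≡ T′ (proj₁ x)
      T≡T′ = Injection.injective (power δ) (,-injectiveʳ (q-injective eq))

      climb-cong : ∀ {p p′ i i′} → p ≡ p′ → i ≡ i′ → proj₁ (climb p i) ≡ proj₁ (climb p′ i′)
      climb-cong refl refl = refl

    value : ∀ η α → ∃[ v ] (v < b α × (∀ w → Prescribed η α w → w ≡ v))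
    value η α with em {P = ∃ (Prescribed η α)}
    ... | yes (v , pv) = v , prescribed-bounded pv , λ w pw → prescribed-unique pw pv
    -- A default value: `b α` is infinite, hence inhabited.
    ... | no ¬∃        = proj₁ z , proj₂ z , λ w pw → contradiction (w , pw) ¬∃
      where
      z : Seg (b α)
      z = Injection.to (proj₂ (b-infinite α)) 0

    family : (Carrier → Bool) → ∏ κ b
    family η = (λ α → proj₁ (value η α)) , λ α → proj₁ (proj₂ (value η α))

    -- One point `α` serves all `i` at once: there each `family (η i)` takes the `i`-th term of the
    -- same cofinal sequence, which `g α` would then bound.
    distinct-family-undominated :
      ∀ g (η : Seg μ → Carrier → Bool) → (∀ i j → (∀ ξ → η i ξ ≡ η j ξ) → i ≡ j) →
      ¬ (∀ i → _≤*_ κ b (family (η i)) g)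
    distinct-family-undominated (g , g<b) η distinct dominated =
      climb-unbounded (code δ T) (g α , g<b α) λ i →
        subst (_≤ g α) (sym (proj₂ (proj₂ (value (η i) α)) _ (prescribed i)))
          (proj₂ (dominated i) α (<-trans (β₁-above i) (<-trans β₁<δ (q-above (code δ T)))))
      where
      table : Σ[ T ∈ (Carrier → Bool) ] (∀ p → T (cell p) ≡ η (proj₁ p) (proj₂ p))
      table = extension em cell cell-injective (uncurry η)

      T = proj₁ table

      separating : Σ[ ξ ∈ (Seg μ × Seg μ → Carrier) ]
        (∀ p → η (proj₁ p) (ξ p) ≡ η (proj₂ p) (ξ p) → proj₁ p ≡ proj₂ p)
      separating = choice separate
        where
        separate : ∀ p → ∃[ ξ ] (η (proj₁ p) ξ ≡ η (proj₂ p) ξ → proj₁ p ≡ proj₂ p)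
        separate (i , j) with em {P = i ≡ j}
        ... | yes i≡j = proj₁ i , λ _ → i≡j
        ... | no i≢j =
          let ξ , ηᵢξ≢ηⱼξ = ¬∀⟶∃¬ em (λ e → i≢j (distinct i j e))
          in ξ , λ e → contradiction e ηᵢξ≢ηⱼξ

      ξ = proj₁ separating

      dominated-bound = bounded κ κ-regular (λ i → proj₁ (dominated i))
      cell-bound = bounded₂ κ κ-regular (λ i j → cell (j , ξ (i , j)))

      β₁ = proj₁ dominated-bound
      β₁-above = proj₂ dominated-bound
      β₂ = proj₁ cell-bound

      -- Beyond `β₁` every domination is in force, and `α` lies above `δ`; being above `β₂`, `δ`
      -- exceeds a separating cell for any two rows.
      above = cofinal₂ κ κ-regular _ cofinal β₁ β₂

      δ = proj₁ above

      β₁<δ : β₁ < δ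
      β₁<δ = proj₁ (proj₂ above)

      cell<δ : ∀ i j → cell (j , ξ (i , j)) < δ
      cell<δ i j = <-trans (proj₂ cell-bound i j) (proj₁ (proj₂ (proj₂ above)))

      α = q (code δ T)

      prescribed : ∀ i → Prescribed (η i) α (proj₁ (climb (code δ T) i))
      prescribed i = δ , T , i , refl , (λ ξ _ → sym (proj₂ table (i , ξ))) ,
        (λ j match → sym (proj₂ separating (i , j)
          (trans (match _ (cell<δ i j)) (proj₂ table (j , _))))) ,
        refl

    -- The size of dominating sets.

    ∏-setoid : Setoid ℓ ℓ
    ∏-setoid = On.setoid {B = ∏ κ b} (Carrier →-setoid Carrier) proj₁

    Enumerates : ∏ κ b → (Seg μ × Carrier → Bool) → Set ℓ
    Enumerates g h = ∀ η → _≤*_ κ b (family η) g → ∃[ i ] (∀ ξ → h (i , ξ) ≡ η ξ)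

    -- The first alternative would give `μ` distinct sets whose functions `g` all dominates, which
    -- is excluded.
    enumeration : ∀ g → ∃ (Enumerates g)
    enumeration g
      with embeds-or-enumerates (κ ↓ μ) (2^ Carrier) (λ _ → false) (λ η → _≤*_ κ b (family η) g)
    ... | inj₁ (h , h≤g , distinct) = contradiction h≤g (distinct-family-undominated g h distinct)
    ... | inj₂ (h , h-onto)         = uncurry h , h-onto

    -- Extensional choice gives pointwise equal functions the same list; the embedding of the power
    -- set into `subset κ b D` relies on this for injectivity.
    enumerate : Σ[ H ∈ Func ∏-setoid ((Seg μ × Carrier) →-setoid Bool) ]
                  (∀ g → Enumerates g (Func.to H g))
    enumerate = ec ∏-setoid _ Enumerates
      (λ { g≈g′ enum η (β , η≤g′) →
           enum η (β , λ α β<α → subst (_ ≤_) (sym (g≈g′ α)) (η≤g′ α β<α)) })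
      (λ h≈h′ enum η η≤g → let i , e = enum η η≤g in i , λ ξ → trans (sym (h≈h′ (i , ξ))) (e ξ))
      enumeration

    private
      module H = Func (proj₁ enumerate)

    -- One `η` can carry an independent target in each row of cells, so entry `i` of the list is
    -- inspected on row `i` only.
    row : Seg μ → ∏ κ b → Carrier → Bool
    row i g ξ = H.to g (i , cell (i , ξ))

    -- Otherwise each `row i` misses some `ζ i`. Glue these into one `η` and take `g` in `D`
    -- dominating `family η`: then `η` is some entry `i` of the list of `g`, so `row i` hits `ζ i`
    -- after all.
    row-onto : ∀ D → IsDominating κ b D →
               ∃[ i ] (∀ ζ → Σ[ g ∈ ∃ D ] (∀ ξ → row i (proj₁ g) ξ ≡ ζ ξ))
    row-onto D dominating = decidable-stable em λ ¬onto →
      diagonal (choice λ i → ¬∀⟶∃¬ em λ onto → ¬onto (i , onto))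
      where
      diagonal : ¬ (∃[ ζ ] ∀ i → ¬ (Σ[ g ∈ ∃ D ] (∀ ξ → row i (proj₁ g) ξ ≡ ζ i ξ)))
      diagonal (ζ , missed)
        with η , η-cell   ← extension em cell cell-injective (uncurry ζ)
        with g , Dg , η≤g ← dominating (family η)
        with i , hᵢ≡η     ← proj₂ enumerate g η η≤g
        = missed i ((g , Dg) , λ ξ → trans (hᵢ≡η _) (η-cell (i , ξ)))

    -- A choice of preimages under a surjective `row i` is injective, since `row i` recovers the
    -- original set.
    2^κ≼dominating : ∀ D → IsDominating κ b D → 2^ Carrier ≼ subset κ b D
    2^κ≼dominating D dominating = record
      { to        = F.to
      ; cong      = F.cong
      ; injective = λ {ζ} {ζ′} e ξ →
          trans (sym (F-row ζ ξ)) (trans (H.cong e _) (F-row ζ′ ξ))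
      }
      where
      onto = row-onto D dominating
      i = proj₁ onto

      chosen = ec (2^ Carrier) (subset κ b D) (λ ζ g → ∀ ξ → row i (proj₁ g) ξ ≡ ζ ξ)
        (λ ζ≈ζ′ e ξ → trans (e ξ) (ζ≈ζ′ ξ))
        (λ g≈g′ e ξ → trans (sym (H.cong g≈g′ _)) (e ξ))
        (proj₂ onto)

      module F = Func (proj₁ chosen)
      F-row = proj₂ chosen

    -- A function is determined by its graph, which `q` turns into a subset of `κ`.
    subset≼2^κ : ∀ D → subset κ b D ≼ 2^ Carrier
    subset≼2^κ D = record
      { to        = λ f β → ⌊ em {P = Graph f β} ⌋
      ; cong      = λ {f} {f′} f≈f′ β →
          ⌊⌋-cong em (graph-resp f f′ f≈f′) (graph-resp f′ f (sym ∘ f≈f′))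
      ; injective = λ {f} {f′} e α →
          let α′ , eq = ⌊⌋-injective em (e _) (α , refl)
              pair≡   = q-injective eq
          in trans (,-injectiveʳ pair≡) (cong (proj₁ (proj₁ f′)) (sym (,-injectiveˡ pair≡)))
      }
      where
      Graph : ∃ D → Carrier → Set ℓ
      Graph ((f , _) , _) β = ∃[ α ] β ≡ q (α , f α)

      graph-resp : ∀ f f′ → Setoid._≈_ (subset κ b D) f f′ → ∀ {β} → Graph f β → Graph f′ β
      graph-resp _ _ f≈f′ (α , refl) = α , cong (λ v → q (α , v)) (f≈f′ α)

    dominatingNumber : IsDominatingNumber κ b (2^ Carrier)
    dominatingNumber =
      (everything , everything-dominating ,
        cantor-bernstein em (subset≼2^κ everything) (2^κ≼dominating everything everything-dominating)) ,
      2^κ≼dominating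
      where
      everything : Pred (∏ κ b) ℓ
      everything _ = ⊤

      everything-dominating : IsDominating κ b everything
      -- Here `f` dominates itself at every point; `μ` is a threshold at hand.
      everything-dominating f = f , _ , μ , λ _ _ → inj₂ refl

theorem3p5 : (∀ {a} → ExcludedMiddle a) →
    (∀ {a ℓ₁ b ℓ₂ r} → ExtensionalChoice a ℓ₁ b ℓ₂ r) →
    ∀ {ℓ : Level} (κ : Ordinal ℓ) → IsInaccessible κ →
    (b : Ordinal.Carrier κ → Ordinal.Carrier κ) →
    IsIncreasing κ b →
    (∀ α → IsInfiniteCardinal (κ ↓ b α)) →
    (μ : Ordinal.Carrier κ) → IsRegularCardinal (κ ↓ μ) →
    CofinallyMany κ (λ α → HasCofinality (κ ↓ b α) (κ ↓ μ)) →
    IsDominatingNumber κ b (2^ (Ordinal.Carrier κ))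
theorem3p5 em ec κ κ-inaccessible b _ b-infinite μ ((_ , ℵ₀≼μ) , _) cofinal =
  dominatingNumber em ec κ κ-inaccessible b b-infinite μ ℵ₀≼μ cofinal
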